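{- For any graph $G$ with $n$ vertices and minimum degree $\delta$, (i) $\alpha_{ir}(G) + \gamma_{ir}(G) \leq n+1$ if $\delta = 0$, and $\alpha_{ir}(G) + \gamma_{ir}(G) \leq n$ if $\delta \geq 1$; (ii) $\alpha_{ir}(G)\, \gamma_{ir}(G) \leq \lfloor \frac{n+1}{2} \rfloor \lceil \frac{n+1}{2} \rceil$ if $\delta = 0$, and $\alpha_{ir}(G)\, \gamma_{ir}(G) \leq \lfloor \frac{n}{2} \rfloor \lceil \frac{n}{2} \rceil$ if $\delta \geq 1$; (iii) $\alpha_{ir}(G) + \gamma_{ir}(\bar{G}) \leq n+1$; (iv) $\alpha_{ir}(G)\, \gamma_{ir}(\bar{G}) \leq \lfloor \frac{n+1}{2} \rfloor \lceil \frac{n+1}{2} \rceil$. Moreover, the bounds are sharp: for each of these inequalities (including each of the two cases $\delta = 0$ and $\delta \geq 1$ in (i) and (ii)), there exist graphs for which equality holds.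
   Context: All graphs are finite, simple, undirected and have at least one vertex. $\bar{G}$ denotes the complement of $G$. An irregular independent set of $G$ is an independent set $A$ of $G$ such that any two distinct vertices in $A$ have different degrees in $G$; $\alpha_{ir}(G)$ is the size of a largest irregular independent set of $G$. $N(v)$ denotes the set of neighbours of a vertex $v$. A dominating set of $G$ is a set $D \subseteq V(G)$ such that every vertex in $V(G)\setminus D$ has a neighbour in $D$. An irregular dominating set of $G$ is a dominating set $D$ of $G$ such that $|N(u) \cap D| \neq |N(v) \cap D|$ for every two distinct vertices $u, v \in V(G) \setminus D$ (in particular, $V(G)$ is one); $\gamma_{ir}(G)$ is the size of a smallest irregular dominating set of $G$. -}

module Defs where

open import Data.Fin using (Fin; fromℕ<)
open import Data.Fin.Properties using (all?; any?; _≟_)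
open import Data.Fin.Subset using (Subset; inside; outside; _∈_; _∉_; _∩_; ∣_∣; ⊥; ⊤)
open import Data.Fin.Subset.Properties using (_∈?_; ∉⊥; ∈⊤)
open import Data.List using (List; []; _∷_; _++_; map; filter; allFin)
open import Data.List.Extrema.Nat using (argmin; argmax; argmin-all; argmax-all; f[argmin]≤f[xs]; f[xs]≤f[argmax])
import Data.List.Membership.Propositional as List
open import Data.List.Membership.Propositional.Properties using (∈-map⁺; ∈-++⁺ˡ; ∈-++⁺ʳ; ∈-filter⁺; ∈-allFin)
open import Data.List.Relation.Unary.All using (lookup)
open import Data.List.Relation.Unary.All.Properties using (all-filter)
open import Data.List.Relation.Unary.Any using (here)
open import Data.Nat using (ℕ; zero; suc; NonZero; >-nonZero⁻¹; _≤_)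
import Data.Nat.Properties as ℕ
open import Data.Product using (∃; _×_; _,_)
open import Data.Vec using ([]; _∷_; tabulate)
open import Level using (0ℓ)
open import Relation.Binary using (Rel; Decidable; Symmetric; Irreflexive)
open import Relation.Binary.PropositionalEquality using (_≡_; _≢_; refl; sym)
open import Relation.Nullary using (¬_; Dec; does; ¬?; contradiction)
open import Relation.Nullary.Decidable using (_×-dec_; _→-dec_)

record Graph : Set₁ where
  infix 4 _~_ _~?_
  field
    order        : ℕ
    {{nonEmpty}} : NonZero order
    _~_          : Rel (Fin order) 0ℓ
    _~?_         : Decidable _~_
    ~-sym        : Symmetric _~_
    ~-irrefl     : Irreflexive _≡_ _~_

  Vertex : Set
  Vertex = Fin order

  N : Vertex → Subset order
  N v = tabulate λ u → does (v ~? u)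

  degree : Vertex → ℕ
  degree v = ∣ N v ∣

  vertex₀ : Vertex
  vertex₀ = fromℕ< (>-nonZero⁻¹ order)

open Graph using (order)

complement : Graph → Graph
complement G = record
  { order    = order G
  ; _~_      = λ u v → u ≢ v × ¬ (u ~ v)
  ; _~?_     = λ u v → ¬? (u ≟ v) ×-dec ¬? (u ~? v)
  ; ~-sym    = λ { (u≢v , u≁v) → (λ v≡u → u≢v (sym v≡u)) , (λ v~u → u≁v (~-sym v~u)) }
  ; ~-irrefl = λ { u≡v (u≢v , _) → u≢v u≡v }
  }
  where open Graph G hiding (order)

module _ (G : Graph) where
  open Graph G hiding (order)

  Independent : Subset (order G) → Set
  Independent A = ∀ u v → u ∈ A → v ∈ A → ¬ (u ~ v)

  IrregularIndependent : Subset (order G) → Set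
  IrregularIndependent A =
    Independent A × (∀ u v → u ∈ A → v ∈ A → u ≢ v → degree u ≢ degree v)

  Dominating : Subset (order G) → Set
  Dominating D = ∀ v → v ∉ D → ∃ λ u → u ∈ D × v ~ u

  IrregularDominating : Subset (order G) → Set
  IrregularDominating D =
    Dominating D × (∀ u v → u ∉ D → v ∉ D → u ≢ v → ∣ N u ∩ D ∣ ≢ ∣ N v ∩ D ∣)

  irregularIndependent? : ∀ A → Dec (IrregularIndependent A)
  irregularIndependent? A =
    all? (λ u → all? λ v → (u ∈? A) →-dec ((v ∈? A) →-dec ¬? (u ~? v)))
    ×-dec
    all? (λ u → all? λ v → (u ∈? A) →-dec ((v ∈? A) →-dec
      (¬? (u ≟ v) →-dec ¬? (degree u ℕ.≟ degree v))))

  irregularDominating? : ∀ D → Dec (IrregularDominating D)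
  irregularDominating? D =
    all? (λ v → ¬? (v ∈? D) →-dec any? λ u → (u ∈? D) ×-dec (v ~? u))
    ×-dec
    all? (λ u → all? λ v → ¬? (u ∈? D) →-dec (¬? (v ∈? D) →-dec
      (¬? (u ≟ v) →-dec ¬? (∣ N u ∩ D ∣ ℕ.≟ ∣ N v ∩ D ∣))))

subsets : ∀ n → List (Subset n)
subsets zero    = [] ∷ []
subsets (suc n) = map (outside ∷_) (subsets n) ++ map (inside ∷_) (subsets n)

∈-subsets : ∀ {n} (p : Subset n) → p List.∈ subsets n
∈-subsets []            = here refl
∈-subsets (outside ∷ p) = ∈-++⁺ˡ (∈-map⁺ (outside ∷_) (∈-subsets p))
∈-subsets {suc n} (inside ∷ p) =
  ∈-++⁺ʳ (map (outside ∷_) (subsets n)) (∈-map⁺ (inside ∷_) (∈-subsets p))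

-- The second argument of argmin and argmax is one more candidate besides the
-- list. It is always admissible below: a vertex for δ, the empty set for αᵢᵣ
-- and V(G) for γᵢᵣ (see ⊥-irregularIndependent and ⊤-irregularDominating).

module _ (G : Graph) where
  open Graph G using (degree; vertex₀)

  δ : ℕ
  δ = degree (argmin degree vertex₀ (allFin (order G)))

  αᵢᵣ : ℕ
  αᵢᵣ = ∣ argmax ∣_∣ ⊥ (filter (irregularIndependent? G) (subsets (order G))) ∣

  γᵢᵣ : ℕ
  γᵢᵣ = ∣ argmin ∣_∣ ⊤ (filter (irregularDominating? G) (subsets (order G))) ∣

  δ-attained : ∃ λ v → degree v ≡ δ
  δ-attained = _ , refl

  δ-minimal : ∀ v → δ ≤ degree v
  δ-minimal v = lookup (f[argmin]≤f[xs] vertex₀ (allFin (order G))) (∈-allFin v)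

  ⊥-irregularIndependent : IrregularIndependent G ⊥
  ⊥-irregularIndependent =
    (λ _ _ u∈⊥ → contradiction u∈⊥ ∉⊥) , (λ _ _ u∈⊥ → contradiction u∈⊥ ∉⊥)

  ⊤-irregularDominating : IrregularDominating G ⊤
  ⊤-irregularDominating =
    (λ _ v∉⊤ → contradiction ∈⊤ v∉⊤) , (λ _ _ u∉⊤ → contradiction ∈⊤ u∉⊤)

  αᵢᵣ-attained : ∃ λ A → IrregularIndependent G A × ∣ A ∣ ≡ αᵢᵣ
  αᵢᵣ-attained = _ , argmax-all ∣_∣ {P = IrregularIndependent G} ⊥-irregularIndependent
    (all-filter (irregularIndependent? G) (subsets (order G))) , refl

  αᵢᵣ-maximal : ∀ A → IrregularIndependent G A → ∣ A ∣ ≤ αᵢᵣ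
  αᵢᵣ-maximal A irr = lookup (f[xs]≤f[argmax] ⊥ _)
    (∈-filter⁺ (irregularIndependent? G) (∈-subsets A) irr)

  γᵢᵣ-attained : ∃ λ D → IrregularDominating G D × ∣ D ∣ ≡ γᵢᵣ
  γᵢᵣ-attained = _ , argmin-all ∣_∣ {P = IrregularDominating G} ⊤-irregularDominating
    (all-filter (irregularDominating? G) (subsets (order G))) , refl

  γᵢᵣ-minimal : ∀ D → IrregularDominating G D → γᵢᵣ ≤ ∣ D ∣
  γᵢᵣ-minimal D irr = lookup (f[argmin]≤f[xs] ⊤ _)
    (∈-filter⁺ (irregularDominating? G) (∈-subsets D) irr)

{-# OPTIONS --safe #-}
-- Let A be an irregular independent set. A vertex v of A has all its neighbours
-- outside A, so |N(v) ∩ V∖A| = deg v, and in the complement graph v has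
-- |V∖A| − deg v neighbours in V∖A. These counts are distinct for distinct v in A,
-- so V∖A is irregular dominating as soon as they are all positive. For G this
-- fails only at an isolated vertex, of which A has at most one; for the complement
-- it suffices to remove an arbitrary w from A, since w is then a neighbour of all
-- the remaining vertices. The product bounds are a consequence of the sum bounds,
-- and K₁ and K₂ give equality.
module Submission where

open import Defs
open import Data.Nat using (_+_; _*_; _≤_; _≥_; ⌊_/2⌋; ⌈_/2⌉)
open import Data.Product using (_×_; ∃-syntax)
open import Relation.Binary.PropositionalEquality using (_≡_)
open Graph using (order)

open import Data.Fin using (Fin)
open import Data.Fin.Properties using (any?; _≟_)
open import Data.Fin.Subset using (Subset; inside; outside; _∈_; _∉_; _⊆_; _∩_; _─_; _-_; ∁; ∣_∣; ⁅_⁆; Nonempty)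
open import Data.Fin.Subset.Properties
  using (_∈?_; nonempty?; Empty-unique; ∣⊥∣≡0; ∣p∣≤n; ∣⁅x⁆∣≡1; ∣∁p∣≡n∸∣p∣; ⊆-antisym;
         p∩q⊆p; p─q⊆p; x∈p∩q⁺; x∈p∩q⁻;
         x∈∁p⇒x∉p; x∉∁p⇒x∈p; x∉p⇒x∈∁p)
open import Data.Nat using (ℕ; zero; suc; _∸_; z≤n; s≤s)
import Data.Nat.Properties as ℕ
open import Data.Nat.Tactic.RingSolver using (solve-∀)
open import Data.Product using (_,_; proj₁; proj₂)
open import Data.Vec using ([]; _∷_; there)
open import Data.Vec.Properties using (lookup∘tabulate; lookup⇒[]=; []=⇒lookup)
open import Function using (_∘_)
open import Relation.Binary.PropositionalEquality
  using (_≢_; refl; sym; trans; cong; cong₂; subst; ≢-sym; module ≡-Reasoning)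
open import Relation.Nullary using (yes; no; ¬?; contradiction)
open import Relation.Nullary.Decidable using (dec-true; dec-false; decidable-stable; _×-dec_)

-- Induction lowering both factors by one: `suc a * suc b` exceeds `a * b` by `a + b + 1`, and the
-- two halves of `m + n` have the same sum as `m` and `n`, so both sides grow equally.
m*n≤⌊m+n/2⌋*⌈m+n/2⌉ : ∀ m n → m * n ≤ ⌊ m + n /2⌋ * ⌈ m + n /2⌉
m*n≤⌊m+n/2⌋*⌈m+n/2⌉ zero    n    = z≤n
m*n≤⌊m+n/2⌋*⌈m+n/2⌉ (suc m) zero = ℕ.≤-trans (ℕ.≤-reflexive (ℕ.*-zeroʳ m)) z≤n
-- After the rewrite the sum is `suc (suc (m + n))`, whose halves compute to `suc f` and `suc c`.
m*n≤⌊m+n/2⌋*⌈m+n/2⌉ (suc m) (suc n) rewrite ℕ.+-suc m n = begin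
  suc m * suc n              ≡⟨ suc*suc m n ⟩
  suc (m * n + (m + n))      ≤⟨ s≤s (ℕ.+-monoˡ-≤ (m + n) (m*n≤⌊m+n/2⌋*⌈m+n/2⌉ m n)) ⟩
  suc (f * c + (m + n))      ≡⟨ cong (λ s → suc (f * c + s)) (ℕ.⌊n/2⌋+⌈n/2⌉≡n (m + n)) ⟨
  suc (f * c + (f + c))      ≡⟨ suc*suc f c ⟨
  suc f * suc c              ∎
  where
  open ℕ.≤-Reasoning
  f = ⌊ m + n /2⌋
  c = ⌈ m + n /2⌉
  suc*suc : ∀ a b → suc a * suc b ≡ suc (a * b + (a + b))
  suc*suc = solve-∀

m+n≤o⇒m*n≤⌊o/2⌋*⌈o/2⌉ : ∀ m n {o} → m + n ≤ o → m * n ≤ ⌊ o /2⌋ * ⌈ o /2⌉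
m+n≤o⇒m*n≤⌊o/2⌋*⌈o/2⌉ m n m+n≤o = ℕ.≤-trans (m*n≤⌊m+n/2⌋*⌈m+n/2⌉ m n)
  (ℕ.*-mono-≤ (ℕ.⌊n/2⌋-mono m+n≤o) (ℕ.⌈n/2⌉-mono m+n≤o))

∣p∩q∣+∣∁p∩q∣≡∣q∣ : ∀ {n} (p q : Subset n) → ∣ p ∩ q ∣ + ∣ ∁ p ∩ q ∣ ≡ ∣ q ∣
∣p∩q∣+∣∁p∩q∣≡∣q∣ []            []            = refl
∣p∩q∣+∣∁p∩q∣≡∣q∣ (inside ∷ p)  (inside ∷ q)  = cong suc (∣p∩q∣+∣∁p∩q∣≡∣q∣ p q)
∣p∩q∣+∣∁p∩q∣≡∣q∣ (outside ∷ p) (inside ∷ q)  =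
  trans (ℕ.+-suc ∣ p ∩ q ∣ ∣ ∁ p ∩ q ∣) (cong suc (∣p∩q∣+∣∁p∩q∣≡∣q∣ p q))
∣p∩q∣+∣∁p∩q∣≡∣q∣ (inside ∷ p)  (outside ∷ q) = ∣p∩q∣+∣∁p∩q∣≡∣q∣ p q
∣p∩q∣+∣∁p∩q∣≡∣q∣ (outside ∷ p) (outside ∷ q) = ∣p∩q∣+∣∁p∩q∣≡∣q∣ p q

-- Equality can fail: elements of `q` outside `p` are counted on the right only.
∣p∣≤∣p─q∣+∣q∣ : ∀ {n} (p q : Subset n) → ∣ p ∣ ≤ ∣ p ─ q ∣ + ∣ q ∣
∣p∣≤∣p─q∣+∣q∣ []            []            = z≤n
∣p∣≤∣p─q∣+∣q∣ (inside ∷ p)  (inside ∷ q)  =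
  ℕ.≤-trans (s≤s (∣p∣≤∣p─q∣+∣q∣ p q)) (ℕ.≤-reflexive (sym (ℕ.+-suc ∣ p ─ q ∣ ∣ q ∣)))
∣p∣≤∣p─q∣+∣q∣ (outside ∷ p) (inside ∷ q)  =
  ℕ.≤-trans (∣p∣≤∣p─q∣+∣q∣ p q) (ℕ.+-monoʳ-≤ ∣ p ─ q ∣ (ℕ.n≤1+n ∣ q ∣))
∣p∣≤∣p─q∣+∣q∣ (inside ∷ p)  (outside ∷ q) = s≤s (∣p∣≤∣p─q∣+∣q∣ p q)
∣p∣≤∣p─q∣+∣q∣ (outside ∷ p) (outside ∷ q) = ∣p∣≤∣p─q∣+∣q∣ p q

∣p∣≤∣p-x∣+1 : ∀ {n} (p : Subset n) x → ∣ p ∣ ≤ ∣ p - x ∣ + 1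
∣p∣≤∣p-x∣+1 p x = subst (λ k → ∣ p ∣ ≤ ∣ p - x ∣ + k) (∣⁅x⁆∣≡1 x) (∣p∣≤∣p─q∣+∣q∣ p ⁅ x ⁆)

x∈p-y⇒x≢y : ∀ {n} {x y : Fin n} (p : Subset n) → x ∈ p - y → x ≢ y
x∈p-y⇒x≢y {x = x} p x∈p-x refl = x∉p-x p x x∈p-x
  where
  x∉p-x : ∀ {n} (p : Subset n) x → x ∉ p - x
  x∉p-x (_ ∷ p) Fin.zero    ()
  x∉p-x (_ ∷ p) (Fin.suc x) (there x∈) = x∉p-x p x x∈

∣p∣≢0⇒Nonempty : ∀ {n} {p : Subset n} → ∣ p ∣ ≢ 0 → Nonempty p
∣p∣≢0⇒Nonempty {n} {p} ∣p∣≢0 = decidable-stable (nonempty? p)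
  λ empty → ∣p∣≢0 (trans (cong ∣_∣ (Empty-unique empty)) (∣⊥∣≡0 n))

module _ (G : Graph) where
  open Graph G hiding (order)

  ∈N⁺ : ∀ {u v} → v ~ u → u ∈ N v
  ∈N⁺ {u} {v} v~u = lookup⇒[]= u (N v) (trans (lookup∘tabulate _ u) (dec-true (v ~? u) v~u))

  ∈N⁻ : ∀ {u v} → u ∈ N v → v ~ u
  ∈N⁻ {u} {v} u∈Nv = decidable-stable (v ~? u) λ v≁u →
    contradiction (trans (sym ([]=⇒lookup u∈Nv)) (trans (lookup∘tabulate _ u) (dec-false (v ~? u) v≁u))) λ ()

  ∁-irregularDominating : ∀ A → Dominating G (∁ A) →
    (∀ u v → u ∈ A → v ∈ A → u ≢ v → ∣ N u ∩ ∁ A ∣ ≢ ∣ N v ∩ ∁ A ∣) →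
    IrregularDominating G (∁ A)
  ∁-irregularDominating A dom irr =
    dom , λ u v u∉∁A v∉∁A → irr u v (x∉∁p⇒x∈p u∉∁A) (x∉∁p⇒x∈p v∉∁A)

  -- The source of all the sum bounds: `∁ A` competes in the minimum defining `γᵢᵣ` and has
  -- `order G ∸ ∣ A ∣` elements.
  ∁-irregularDominating⇒∣A∣+γ≤n : ∀ A → IrregularDominating G (∁ A) → ∣ A ∣ + γᵢᵣ G ≤ order G
  ∁-irregularDominating⇒∣A∣+γ≤n A irr = begin
    ∣ A ∣ + γᵢᵣ G             ≤⟨ ℕ.+-monoʳ-≤ ∣ A ∣ (γᵢᵣ-minimal G (∁ A) irr) ⟩
    ∣ A ∣ + ∣ ∁ A ∣           ≡⟨ cong (∣ A ∣ +_) (∣∁p∣≡n∸∣p∣ A) ⟩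
    ∣ A ∣ + (order G ∸ ∣ A ∣)   ≡⟨ ℕ.m+[n∸m]≡n (∣p∣≤n A) ⟩
    order G                   ∎
    where open ℕ.≤-Reasoning

  module _ {A : Subset (order G)} (irr : IrregularIndependent G A) where

    ⊆-irregularIndependent : ∀ {B} → B ⊆ A → IrregularIndependent G B
    ⊆-irregularIndependent B⊆A =
      (λ u v u∈B v∈B → proj₁ irr u v (B⊆A u∈B) (B⊆A v∈B)) ,
      (λ u v u∈B v∈B → proj₂ irr u v (B⊆A u∈B) (B⊆A v∈B))

    N⊆∁A : ∀ {v} → v ∈ A → N v ⊆ ∁ A
    N⊆∁A {v} v∈A {u} u∈Nv = x∉p⇒x∈∁p λ u∈A → proj₁ irr v u v∈A u∈A (∈N⁻ u∈Nv)

    ∣N∩∁A∣≡degree : ∀ {v} → v ∈ A → ∣ N v ∩ ∁ A ∣ ≡ degree v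
    ∣N∩∁A∣≡degree {v} v∈A = cong ∣_∣
      (⊆-antisym (p∩q⊆p (N v) (∁ A)) λ u∈Nv → x∈p∩q⁺ (u∈Nv , N⊆∁A v∈A u∈Nv))

    ∁-irregularDominating-graph : (∀ v → v ∈ A → degree v ≢ 0) → IrregularDominating G (∁ A)
    ∁-irregularDominating-graph deg≢0 = ∁-irregularDominating A dom λ u v u∈A v∈A u≢v eq →
      proj₂ irr u v u∈A v∈A u≢v
        (trans (sym (∣N∩∁A∣≡degree u∈A)) (trans eq (∣N∩∁A∣≡degree v∈A)))
      where
      dom : Dominating G (∁ A)
      dom v v∉∁A with v∈A ← x∉∁p⇒x∈p v∉∁A
        -- A nonzero degree supplies a neighbour, and independence of `A` places it in `∁ A`.
        with u , u∈Nv ← ∣p∣≢0⇒Nonempty (deg≢0 v v∈A)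
        = u , N⊆∁A v∈A u∈Nv , ∈N⁻ u∈Nv

module _ (G : Graph) {A : Subset (order G)} (irr : IrregularIndependent G A) where
  open Graph G hiding (order)

  private
    N̅ : Vertex → Subset (order G)
    N̅ = Graph.N (complement G)

  -- `N̅ v` and `∁ (N v)` differ only at `v` itself, and intersecting with `∁ A` discards `v`.
  N̅∩∁A≡∁N∩∁A : ∀ {v} → v ∈ A → N̅ v ∩ ∁ A ≡ ∁ (N v) ∩ ∁ A
  N̅∩∁A≡∁N∩∁A {v} v∈A = ⊆-antisym to from
    where
    to : N̅ v ∩ ∁ A ⊆ ∁ (N v) ∩ ∁ A
    to u∈ with u∈N̅v , u∈∁A ← x∈p∩q⁻ (N̅ v) (∁ A) u∈
      = x∈p∩q⁺ (x∉p⇒x∈∁p (proj₂ (∈N⁻ (complement G) u∈N̅v) ∘ ∈N⁻ G) , u∈∁A)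
    from : ∁ (N v) ∩ ∁ A ⊆ N̅ v ∩ ∁ A
    from u∈ with u∈∁Nv , u∈∁A ← x∈p∩q⁻ (∁ (N v)) (∁ A) u∈
      = x∈p∩q⁺ (∈N⁺ (complement G) ((λ { refl → x∈∁p⇒x∉p u∈∁A v∈A }) , x∈∁p⇒x∉p u∈∁Nv ∘ ∈N⁺ G) , u∈∁A)

  -- The neighbours and non-neighbours of `v` partition `∁ A`, and all neighbours of `v` lie there.
  degree+∣N̅∩∁A∣≡∣∁A∣ : ∀ {v} → v ∈ A → degree v + ∣ N̅ v ∩ ∁ A ∣ ≡ ∣ ∁ A ∣
  degree+∣N̅∩∁A∣≡∣∁A∣ {v} v∈A = trans
    (cong₂ _+_ (sym (∣N∩∁A∣≡degree G irr v∈A)) (cong ∣_∣ (N̅∩∁A≡∁N∩∁A v∈A)))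
    (∣p∩q∣+∣∁p∩q∣≡∣q∣ (N v) (∁ A))

  -- Degree and complement count have the same sum for every vertex of `A`, so equal counts would
  -- force equal degrees. Domination is a hypothesis because a vertex of `A` may be adjacent in `G`
  -- to all of `∁ A`.
  ∁-irregularDominating-complement :
    Dominating (complement G) (∁ A) → IrregularDominating (complement G) (∁ A)
  ∁-irregularDominating-complement dom =
    ∁-irregularDominating (complement G) A dom λ u v u∈A v∈A u≢v eq →
      proj₂ irr u v u∈A v∈A u≢v (ℕ.+-cancelʳ-≡ ∣ N̅ u ∩ ∁ A ∣ (degree u) (degree v) (begin
        degree u + ∣ N̅ u ∩ ∁ A ∣  ≡⟨ degree+∣N̅∩∁A∣≡∣∁A∣ u∈A ⟩
        ∣ ∁ A ∣                   ≡⟨ degree+∣N̅∩∁A∣≡∣∁A∣ v∈A ⟨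
        degree v + ∣ N̅ v ∩ ∁ A ∣  ≡⟨ cong (degree v +_) eq ⟨
        degree v + ∣ N̅ u ∩ ∁ A ∣  ∎))
    where open ≡-Reasoning

-- Accounts for the `+ 1` in the bounds: it is the price of dropping one vertex from `A`.
∣p-x∣+k≤n⇒∣p∣+k≤n+1 : ∀ {n k} (p : Subset n) x → ∣ p - x ∣ + k ≤ n → ∣ p ∣ + k ≤ n + 1
∣p-x∣+k≤n⇒∣p∣+k≤n+1 {n} {k} p x ∣p-x∣+k≤n = begin
  ∣ p ∣ + k            ≤⟨ ℕ.+-monoˡ-≤ k (∣p∣≤∣p-x∣+1 p x) ⟩
  ∣ p - x ∣ + 1 + k    ≡⟨ shift ∣ p - x ∣ k ⟩
  ∣ p - x ∣ + k + 1    ≤⟨ ℕ.+-monoˡ-≤ 1 ∣p-x∣+k≤n ⟩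
  n + 1                ∎
  where
  open ℕ.≤-Reasoning
  shift : ∀ a b → a + 1 + b ≡ a + b + 1
  shift = solve-∀

module _ (G : Graph) where
  open Graph G hiding (order)

  δ≥1⇒α+γ≤n : δ G ≥ 1 → αᵢᵣ G + γᵢᵣ G ≤ order G
  δ≥1⇒α+γ≤n δ≥1 with A , irr , ∣A∣≡α ← αᵢᵣ-attained G
    = subst (λ a → a + γᵢᵣ G ≤ order G) ∣A∣≡α
        (∁-irregularDominating⇒∣A∣+γ≤n G A (∁-irregularDominating-graph G irr
          λ v _ → ℕ.m<n⇒n≢0 (ℕ.≤-trans δ≥1 (δ-minimal G v))))

  α+γ≤n+1 : αᵢᵣ G + γᵢᵣ G ≤ order G + 1
  α+γ≤n+1 with A , irr , ∣A∣≡α ← αᵢᵣ-attained G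
    = subst (λ a → a + γᵢᵣ G ≤ order G + 1) ∣A∣≡α bound
    where
    bound : ∣ A ∣ + γᵢᵣ G ≤ order G + 1
    bound with any? (λ w → (w ∈? A) ×-dec (degree w ℕ.≟ 0))
    ... | no no-isolated = ℕ.m≤n⇒m≤n+o 1
      (∁-irregularDominating⇒∣A∣+γ≤n G A (∁-irregularDominating-graph G irr
        λ v v∈A deg≡0 → no-isolated (v , v∈A , deg≡0)))
    -- An isolated vertex left in `A - w` would share degree 0 with `w`, against irregularity.
    ... | yes (w , w∈A , deg-w≡0) = ∣p-x∣+k≤n⇒∣p∣+k≤n+1 A w
      (∁-irregularDominating⇒∣A∣+γ≤n G (A - w) (∁-irregularDominating-graph G
        (⊆-irregularIndependent G irr (p─q⊆p A ⁅ w ⁆))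
        λ v v∈A-w deg-v≡0 → proj₂ irr v w (p─q⊆p A ⁅ w ⁆ v∈A-w) w∈A
          (x∈p-y⇒x≢y A v∈A-w) (trans deg-v≡0 (sym deg-w≡0))))

  α+γ̅≤n+1 : αᵢᵣ G + γᵢᵣ (complement G) ≤ order G + 1
  α+γ̅≤n+1 with A , irr , ∣A∣≡α ← αᵢᵣ-attained G
    = subst (λ a → a + γᵢᵣ (complement G) ≤ order G + 1) ∣A∣≡α bound
    where
    bound : ∣ A ∣ + γᵢᵣ (complement G) ≤ order G + 1
    bound with nonempty? A
    -- With `A` empty no vertex lies outside `∁ A`, so domination is vacuous.
    ... | no empty = ℕ.m≤n⇒m≤n+o 1
      (∁-irregularDominating⇒∣A∣+γ≤n (complement G) A (∁-irregularDominating-complement G irr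
        λ v v∉∁A → contradiction (v , x∉∁p⇒x∈p v∉∁A) empty))
    ... | yes (w , w∈A) = ∣p-x∣+k≤n⇒∣p∣+k≤n+1 A w
      (∁-irregularDominating⇒∣A∣+γ≤n (complement G) (A - w) (∁-irregularDominating-complement G
        (⊆-irregularIndependent G irr (p─q⊆p A ⁅ w ⁆)) dom))
      where
      dom : Dominating (complement G) (∁ (A - w))
      dom v v∉∁ with v∈A-w ← x∉∁p⇒x∈p v∉∁
        -- The removed `w` now belongs to the dominating set, and independence of `A` makes it
        -- adjacent in the complement to every remaining `v`.
        = w , x∉p⇒x∈∁p (λ w∈A-w → x∈p-y⇒x≢y A w∈A-w refl) ,
          x∈p-y⇒x≢y A v∈A-w , proj₁ irr v w (p─q⊆p A ⁅ w ⁆ v∈A-w) w∈A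

-- Indexed by one less than the order, so that the `NonZero` instance is found.
completeGraph-suc : ℕ → Graph
completeGraph-suc n = record
  { order    = suc n
  ; _~_      = _≢_
  ; _~?_     = λ u v → ¬? (u ≟ v)
  ; ~-sym    = ≢-sym
  ; ~-irrefl = λ u≡v u≢v → u≢v u≡v
  }

theorem5p1 : ( ∀ (G : Graph) → let n = order G in
    ( (δ G ≡ 0 → αᵢᵣ G + γᵢᵣ G ≤ n + 1)
    × (δ G ≥ 1 → αᵢᵣ G + γᵢᵣ G ≤ n) )
    × ( (δ G ≡ 0 → αᵢᵣ G * γᵢᵣ G ≤ ⌊ n + 1 /2⌋ * ⌈ n + 1 /2⌉)
    × (δ G ≥ 1 → αᵢᵣ G * γᵢᵣ G ≤ ⌊ n /2⌋ * ⌈ n /2⌉) )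
    × αᵢᵣ G + γᵢᵣ (complement G) ≤ n + 1
    × αᵢᵣ G * γᵢᵣ (complement G) ≤ ⌊ n + 1 /2⌋ * ⌈ n + 1 /2⌉ )
    × (∃[ G ] δ G ≡ 0 × αᵢᵣ G + γᵢᵣ G ≡ order G + 1)
    × (∃[ G ] δ G ≥ 1 × αᵢᵣ G + γᵢᵣ G ≡ order G)
    × (∃[ G ] δ G ≡ 0 × αᵢᵣ G * γᵢᵣ G ≡ ⌊ order G + 1 /2⌋ * ⌈ order G + 1 /2⌉)
    × (∃[ G ] δ G ≥ 1 × αᵢᵣ G * γᵢᵣ G ≡ ⌊ order G /2⌋ * ⌈ order G /2⌉)
    × (∃[ G ] αᵢᵣ G + γᵢᵣ (complement G) ≡ order G + 1)
    × (∃[ G ] αᵢᵣ G * γᵢᵣ (complement G) ≡ ⌊ order G + 1 /2⌋ * ⌈ order G + 1 /2⌉)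
theorem5p1 =
  (λ G →
      ((λ _ → α+γ≤n+1 G) , δ≥1⇒α+γ≤n G)
    , ((λ _ → m+n≤o⇒m*n≤⌊o/2⌋*⌈o/2⌉ (αᵢᵣ G) (γᵢᵣ G) (α+γ≤n+1 G)) ,
       m+n≤o⇒m*n≤⌊o/2⌋*⌈o/2⌉ (αᵢᵣ G) (γᵢᵣ G) ∘ δ≥1⇒α+γ≤n G)
    , α+γ̅≤n+1 G
    , m+n≤o⇒m*n≤⌊o/2⌋*⌈o/2⌉ (αᵢᵣ G) (γᵢᵣ (complement G)) (α+γ̅≤n+1 G))
  -- Both K₁, which is its own complement, and K₂ have `αᵢᵣ` and `γᵢᵣ` equal to 1, so the sums are 2
  -- and the products 1. Each `refl` evaluates the search over all subsets.
  , (completeGraph-suc 0 , refl , refl)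
  , (completeGraph-suc 1 , s≤s z≤n , refl)
  , (completeGraph-suc 0 , refl , refl)
  , (completeGraph-suc 1 , s≤s z≤n , refl)
  , (completeGraph-suc 0 , refl)
  , (completeGraph-suc 0 , refl)
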